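{- Let $G$ be an edge-colored graph on $n$ vertices. If $d^{c}(v)\geq (n+1)/2$ for every vertex $v\in V(G)$, then $G$ contains a rainbow triangle.
   Context: All graphs are simple and finite, with at least one vertex. An edge-colored graph is a graph $G=(V,E)$ together with an arbitrary mapping $C:E\to\mathbb{N}$ (not required to be a proper edge-coloring). For a vertex $v$ of $G$, the color degree $d^c(v)$ is the number of distinct colors appearing on the edges incident to $v$. A rainbow triangle is a triangle of $G$ whose three edges have pairwise distinct colors. -}

module Defs where

open import Data.Fin using (Fin)
open import Data.List using (List; allFin; deduplicate; length; mapMaybe)
open import Data.Maybe using (Maybe; just; nothing)
open import Data.Nat using (ℕ)
open import Data.Nat.Properties using (_≟_)
open import Data.Product using (_×_)
open import Level using (0ℓ)
open import Relation.Binary.Core using (Rel)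
open import Relation.Binary.Definitions using (Decidable; Irreflexive; Symmetric)
open import Relation.Binary.PropositionalEquality using (_≡_; _≢_)
open import Relation.Nullary using (yes; no)

record SimpleGraph (n : ℕ) : Set₁ where
  field
    _∼_    : Rel (Fin n) 0ℓ
    _∼?_   : Decidable _∼_
    irrefl : Irreflexive _≡_ _∼_
    sym    : Symmetric _∼_

-- An edge is an unordered pair of adjacent vertices, so the colour depends
-- neither on the proof of adjacency (the irrelevant argument) nor on the
-- orientation (colour-sym).
record EdgeColouredGraph (n : ℕ) : Set₁ where
  field
    graph : SimpleGraph n
  open SimpleGraph graph public
  field
    colour     : ∀ u v → .(u ∼ v) → ℕ
    colour-sym : ∀ u v .(e : u ∼ v) → colour u v e ≡ colour v u (sym e)

  colourIfAdjacent : Fin n → Fin n → Maybe ℕ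
  colourIfAdjacent v u with v ∼? u
  ... | yes e = just (colour v u e)
  ... | no  _ = nothing

  incidentColours : Fin n → List ℕ
  incidentColours v = mapMaybe (colourIfAdjacent v) (allFin n)

  colourDegree : Fin n → ℕ
  colourDegree v = length (deduplicate _≟_ (incidentColours v))

  -- The three vertices are distinct by irreflexivity.
  record Triangle : Set where
    field
      a b c : Fin n
      ab    : a ∼ b
      bc    : b ∼ c
      ca    : c ∼ a

  Rainbow : Triangle → Set
  Rainbow t = colour a b ab ≢ colour b c bc
            × colour b c bc ≢ colour c a ca
            × colour c a ca ≢ colour a b ab
    where open Triangle t

{-# OPTIONS --safe #-}
-- More generally, on k ≥ 1 vertices without a rainbow triangle the colour
-- degrees sum to less than k (k + 1) / 2.  By induction on k it is enough to
-- find a vertex w whose deletion lowers that sum by at most k.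
--
-- Call v a leaf at w if vw is the only edge at v of its colour, and let s(w) be
-- the number of colours on the edges from w to its leaves.  Deleting w costs
-- d^c(w) plus the number of leaves at w.  This is at most s(w) + d(w), since
-- each colour at w not counted by s(w) has an edge from w to a non-leaf.  If w is
-- a leaf at v, then s(v) + d(w) ≤ k: every colour counted by s(v) occurs on an
-- edge from v to a non-neighbour of w.  So, for v maximising s, any leaf w at v
-- will do; and if v has no leaf, then s = 0 and every vertex will do.
module Submission where

open import Defs
open import Algebra.Properties.CommutativeSemigroup using (x∙yz≈y∙xz)
open import Data.Empty using (⊥; ⊥-elim)
open import Data.Fin using (Fin)
import Data.Fin.Properties as Fin
open import Data.Integer using (+_)
import Data.Integer as ℤ
import Data.Integer.Properties as ℤ
open import Data.List
  using (List; []; _∷_; _++_; allFin; deduplicate; filter; length; map; mapMaybe)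
open import Data.List.Extrema.Nat using (argmax; argmax-sel; f[⊥]≤f[argmax]; f[xs]≤f[argmax])
open import Data.List.Membership.Propositional using (_∈_)
open import Data.List.Membership.Propositional.Properties
  using (∈-++⁺ˡ; ∈-++⁺ʳ; ∈-∃++; ∈-deduplicate⁺; ∈-deduplicate⁻; ∈-filter⁺; ∈-filter⁻)
import Data.List.Membership.DecPropositional as DecMembership
open import Data.List.Properties using (length-++; length-filter; length-mapMaybe; length-tabulate)
open import Data.List.Relation.Binary.Permutation.Propositional using (_↭_; ↭-sym)
open import Data.List.Relation.Binary.Permutation.Propositional.Properties
  using (∈-resp-↭; filter-↭; mapMaybe-↭; map⁺; shift; ↭-length)
open import Data.List.Relation.Binary.Subset.Propositional using (_⊆_)
open import Data.List.Relation.Unary.All as All using (All; []; _∷_; all?)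
open import Data.List.Relation.Unary.AllPairs using ([]; _∷_)
open import Data.List.Relation.Unary.Any using (here; there)
open import Data.List.Relation.Unary.Unique.Propositional using (Unique)
open import Data.List.Relation.Unary.Unique.DecPropositional.Properties using (deduplicate-!)
open import Data.Maybe using (Maybe; just; nothing)
import Data.Maybe.Properties as Maybe
open import Data.Nat using (ℕ; zero; suc; pred; NonZero; _+_; _*_; _≤_; _<_; z≤n; s≤s)
open import Data.Nat.ListAction using (sum)
open import Data.Nat.ListAction.Properties using (sum-↭)
open import Data.Nat.Properties
open import Data.Nat.Solver using (module +-*-Solver)
open import Data.Product using (∃; _×_; _,_; proj₁; proj₂)
open import Data.Rational.Unnormalised using (_/_; _≥_; *≤*)
open import Data.Sum using (inj₁; inj₂)
open import Function using (_∘_; id)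
open import Relation.Binary.Definitions using (DecidableEquality)
open import Relation.Binary.PropositionalEquality
open import Relation.Nullary using (¬_; Dec; yes; no; contradiction; ¬?; _×-dec_; _→-dec_)
open import Relation.Nullary.Decidable using (map′)
open import Relation.Unary using (Decidable)

-- Counting, summing and maximising over finite lists.

module _ {a} {A : Set a} where

  -- Delete one occurrence of the head of `xs` from `ys`: as `xs` has no repetitions, its tail still
  -- lies in what is left.
  Unique∧⊆⇒length≤ : ∀ {xs ys : List A} → Unique xs → xs ⊆ ys → length xs ≤ length ys
  Unique∧⊆⇒length≤ {[]} _ _ = z≤n
  Unique∧⊆⇒length≤ {x ∷ xs} {ys} (x∉xs ∷ xs!) sub
    with ps , qs , refl ← ∈-∃++ (sub (here refl)) =
    subst (suc (length xs) ≤_) (sym (↭-length ys↭)) (s≤s (Unique∧⊆⇒length≤ xs! sub′))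
    where
    ys↭ : ys ↭ x ∷ ps ++ qs
    ys↭ = shift x ps qs
    sub′ : xs ⊆ ps ++ qs
    sub′ z∈xs with ∈-resp-↭ ys↭ (sub (there z∈xs))
    ... | here refl = contradiction refl (All.lookup x∉xs z∈xs)
    ... | there z∈ = z∈

  maximiser : ∀ (f : A → ℕ) x xs →
    ∃ λ v → v ∈ x ∷ xs × (∀ {w} → w ∈ x ∷ xs → f w ≤ f v)
  maximiser f x xs = argmax f x xs , argmax∈ , λ
    { (here refl) → f[⊥]≤f[argmax] {f = f} x xs
    ; (there w∈)  → All.lookup (f[xs]≤f[argmax] {f = f} x xs) w∈ }
    where
    argmax∈ : argmax f x xs ∈ x ∷ xs
    argmax∈ with argmax-sel f x xs
    ... | inj₁ eq = here eq
    ... | inj₂ v∈ = there v∈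

  length-filter-disjoint : ∀ {p q r} {P : A → Set p} {Q : A → Set q} {R : A → Set r}
    (P? : Decidable P) (Q? : Decidable Q) (R? : Decidable R) →
    (∀ {x} → P x → Q x → ⊥) → (∀ {x} → P x → R x) → (∀ {x} → Q x → R x) →
    ∀ xs → length (filter P? xs) + length (filter Q? xs) ≤ length (filter R? xs)
  length-filter-disjoint P? Q? R? PQ PR QR [] = z≤n
  length-filter-disjoint P? Q? R? PQ PR QR (x ∷ xs)
    with ih ← length-filter-disjoint P? Q? R? PQ PR QR xs | P? x | Q? x | R? x
  ... | yes p | yes q | _     = ⊥-elim (PQ p q)
  ... | yes p | no _  | no ¬r = contradiction (PR p) ¬r
  ... | no _  | yes q | no ¬r = contradiction (QR q) ¬r
  ... | yes _ | no _  | yes _ = s≤s ih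
  ... | no _  | yes _ | yes _ = ≤-trans (≤-reflexive (+-suc (length (filter P? xs)) _)) (s≤s ih)
  ... | no _  | no _  | yes _ = m≤n⇒m≤1+n ih
  ... | no _  | no _  | no _  = ih

  length-filter-∷ : ∀ {p} {P : A → Set p} (P? : Decidable P) x xs →
    length (filter P? xs) ≤ length (filter P? (x ∷ xs))
  length-filter-∷ P? x xs with P? x
  ... | yes _ = n≤1+n _
  ... | no _  = ≤-refl

  length-filter+∁ : ∀ {p} {P : A → Set p} (P? : Decidable P) xs →
    length (filter (¬? ∘ P?) xs) + length (filter P? xs) ≡ length xs
  length-filter+∁ P? [] = refl
  length-filter+∁ P? (x ∷ xs) with P? x
  ... | yes _ = trans (+-suc _ _) (cong suc (length-filter+∁ P? xs))
  ... | no _  = cong suc (length-filter+∁ P? xs)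

  -- Meant for the deletion of a vertex: `f` and `g` are the colour degrees before and after, and
  -- `P` holds at the vertices that may lose a colour.
  sum-map-≤ : ∀ {p} {P : A → Set p} (P? : Decidable P) {f g : A → ℕ} →
    (∀ x → f x ≤ suc (g x)) → (∀ x → ¬ P x → f x ≤ g x) →
    ∀ xs → sum (map f xs) ≤ length (filter P? xs) + sum (map g xs)
  sum-map-≤ P? f≤1+g f≤g [] = z≤n
  sum-map-≤ P? {f} {g} f≤1+g f≤g (x ∷ xs)
    with ih ← sum-map-≤ P? {f} {g} f≤1+g f≤g xs | P? x
  ... | yes _ = ≤-trans (+-mono-≤ (f≤1+g x) ih) (≤-reflexive (cong suc (x∙yz≈y∙xz +-commutativeSemigroup (g x) (length (filter P? xs)) _)))
  ... | no ¬p = ≤-trans (+-mono-≤ (f≤g x ¬p) ih) (≤-reflexive (x∙yz≈y∙xz +-commutativeSemigroup (g x) (length (filter P? xs)) _))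

  length*m≤k*sum : ∀ {f : A → ℕ} {m} k → (∀ x → m ≤ f x * k) → ∀ xs → length xs * m ≤ sum (map f xs) * k
  length*m≤k*sum k m≤ [] = z≤n
  length*m≤k*sum {f} k m≤ (x ∷ xs) =
    ≤-trans (+-mono-≤ (m≤ x) (length*m≤k*sum k m≤ xs)) (≤-reflexive (sym (*-distribʳ-+ k (f x) _)))

-- Membership in the image of a partial function.

module _ {a b} {A : Set a} {B : Set b} {f : A → Maybe B} where

  ∈-mapMaybe⁺ : ∀ {x y xs} → x ∈ xs → f x ≡ just y → y ∈ mapMaybe f xs
  ∈-mapMaybe⁺ {xs = x ∷ _} (here refl) eq rewrite eq = here refl
  ∈-mapMaybe⁺ {xs = z ∷ _} (there x∈) eq with f z
  ... | just _  = there (∈-mapMaybe⁺ x∈ eq)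
  ... | nothing = ∈-mapMaybe⁺ x∈ eq

  ∈-mapMaybe⁻ : ∀ {y} xs → y ∈ mapMaybe f xs → ∃ λ x → x ∈ xs × f x ≡ just y
  ∈-mapMaybe⁻ (x ∷ xs) y∈ with f x in eq | y∈
  ... | just _  | here refl = x , here refl , eq
  ... | just _  | there y∈′ = let z , z∈ , eq′ = ∈-mapMaybe⁻ xs y∈′ in z , there z∈ , eq′
  ... | nothing | y∈′       = let z , z∈ , eq′ = ∈-mapMaybe⁻ xs y∈′ in z , there z∈ , eq′

-- Numbers of distinct values.

module _ {c} {C : Set c} (_≟ᶜ_ : DecidableEquality C) where

  distinct : List C → ℕ
  distinct = length ∘ deduplicate _≟ᶜ_

  distinct≤length : ∀ {xs ys} → xs ⊆ ys → distinct xs ≤ length ys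
  distinct≤length {xs} sub =
    Unique∧⊆⇒length≤ (deduplicate-! _≟ᶜ_ xs) (sub ∘ ∈-deduplicate⁻ _≟ᶜ_ xs)

  distinct-mono : ∀ {xs ys} → xs ⊆ ys → distinct xs ≤ distinct ys
  distinct-mono {xs} {ys} sub = distinct≤length {xs} (∈-deduplicate⁺ _≟ᶜ_ ∘ sub)

-- Colourings without rainbow triangles.

-- K v u is the colour of the edge vu, or nothing if v and u are not adjacent.
module RainbowFree {a c} {A : Set a} {C : Set c}
  (_≟ᵛ_ : DecidableEquality A) (_≟ᶜ_ : DecidableEquality C)
  (K : A → A → Maybe C)
  (K-irrefl : ∀ v → K v v ≡ nothing)
  (K-sym : ∀ u v → K u v ≡ K v u)
  (rainbow-free : ∀ {u v w x y z} → K u v ≡ just x → K v w ≡ just y → K w u ≡ just z →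
    x ≢ y → y ≢ z → z ≢ x → ⊥)
  where

  open DecMembership _≟ᶜ_ using (_∈?_)

  Adj : A → A → Set c
  Adj v u = ∃ λ x → K v u ≡ just x

  adj? : ∀ v → Decidable (Adj v)
  adj? v u with K v u
  ... | just x  = yes (x , refl)
  ... | nothing = no λ ()

  adj⇒≢ : ∀ {v u} → Adj v u → u ≢ v
  adj⇒≢ {v} (_ , eq) refl with () ← trans (sym (K-irrefl v)) eq

  -- The list `S` stands for the current vertex set and `K` stays fixed, so deleting a vertex only
  -- means removing a list entry.
  colours : List A → A → List C
  colours S v = mapMaybe (K v) S

  colourDeg : List A → A → ℕ
  colourDeg S v = distinct _≟ᶜ_ (colours S v)

  deg : List A → A → ℕ
  deg S v = length (filter (adj? v) S)

  -- The vertex `v` is a leaf at `w`. The colours are compared as `Maybe` values: adjacency makes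
  -- `K v w` a `just`, so an `x` not adjacent to `v` satisfies the implication vacuously.
  Leaf : List A → A → A → Set _
  Leaf S w v = Adj w v × All (λ x → K v x ≡ K v w → x ≡ w) S

  leaf? : ∀ S w → Decidable (Leaf S w)
  leaf? S w v = adj? w v ×-dec all? (λ x → Maybe.≡-dec _≟ᶜ_ (K v x) (K v w) →-dec (x ≟ᵛ w)) S

  leaves : List A → A → List A
  leaves S w = filter (leaf? S w) S

  -- This is s(w), taken within `S`.
  leafColourDeg : List A → A → ℕ
  leafColourDeg S w = colourDeg (leaves S w) w

  colourDegSum : List A → ℕ
  colourDegSum S = sum (map (colourDeg S) S)

  -- The cost of deleting a vertex.

  colourDeg-↭ : ∀ {S T} → S ↭ T → ∀ v → colourDeg S v ≡ colourDeg T v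
  colourDeg-↭ S↭T v = ≤-antisym
    (distinct-mono _≟ᶜ_ (∈-resp-↭ (mapMaybe-↭ (K v) S↭T)))
    (distinct-mono _≟ᶜ_ (∈-resp-↭ (mapMaybe-↭ (K v) (↭-sym S↭T))))

  colourDeg-∷ : ∀ S w v → colourDeg (w ∷ S) v ≤ suc (colourDeg S v)
  colourDeg-∷ S w v with K v w
  ... | nothing = n≤1+n _
  ... | just _  = s≤s (length-filter _ (deduplicate _≟ᶜ_ (colours S v)))

  -- If the colour of `vw` is absent from the edges between `v` and `S`, then `vw` is the only edge
  -- of its colour at `v`, which makes `v` a leaf at `w`.
  colourDeg-∷-¬leaf : ∀ S w v → ¬ Leaf (w ∷ S) w v → colourDeg (w ∷ S) v ≤ colourDeg S v
  colourDeg-∷-¬leaf S w v ¬leaf with K v w in eq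
  ... | nothing = ≤-refl
  ... | just x with x ∈? colours S v
  ...   | yes x∈ = distinct-mono _≟ᶜ_ λ { (here refl) → x∈ ; (there z∈) → z∈ }
  ...   | no x∉  = contradiction
    ((x , trans (K-sym w v) eq) , (λ _ → refl) ∷ All.tabulate λ z∈ eq′ →
      contradiction (∈-mapMaybe⁺ z∈ eq′) x∉)
    ¬leaf

  -- The summand of `w` disappears, each leaf at `w` loses at most one colour, and no other vertex
  -- loses any.
  deletion-cost : ∀ {S T w} → T ↭ w ∷ S →
    colourDegSum T ≤ colourDeg T w + length (leaves T w) + colourDegSum S
  deletion-cost {S} {T} {w} T↭ = begin
    colourDegSum T
      ≡⟨ sum-↭ (map⁺ (colourDeg T) T↭) ⟩
    colourDeg T w + sum (map (colourDeg T) S)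
      ≤⟨ +-monoʳ-≤ (colourDeg T w) (sum-map-≤ L? cost≤1 cost≤0 S) ⟩
    colourDeg T w + (length (filter L? S) + colourDegSum S)
      ≤⟨ +-monoʳ-≤ (colourDeg T w) (+-monoˡ-≤ (colourDegSum S) filter≤) ⟩
    colourDeg T w + (length (leaves T w) + colourDegSum S)
      ≡⟨ +-assoc (colourDeg T w) _ _ ⟨
    colourDeg T w + length (leaves T w) + colourDegSum S ∎
    where
    open ≤-Reasoning
    L? = leaf? T w
    cost≤1 : ∀ v → colourDeg T v ≤ suc (colourDeg S v)
    cost≤1 v = ≤-trans (≤-reflexive (colourDeg-↭ T↭ v)) (colourDeg-∷ S w v)
    cost≤0 : ∀ v → ¬ Leaf T w v → colourDeg T v ≤ colourDeg S v
    cost≤0 v ¬leaf = ≤-trans (≤-reflexive (colourDeg-↭ T↭ v))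
      (colourDeg-∷-¬leaf S w v λ (adj , unique) →
        ¬leaf (adj , All.tabulate (All.lookup unique ∘ ∈-resp-↭ T↭)))
    filter≤ : length (filter L? S) ≤ length (leaves T w)
    filter≤ = ≤-trans (length-filter-∷ L? w S) (≤-reflexive (sym (↭-length (filter-↭ L? T↭))))

  -- A colour at `w` that is not on an edge to a leaf is on an edge to one of `others`, the
  -- neighbours that are not leaves; these and the leaves are disjoint sets of neighbours.
  colourDeg+leaves≤ : ∀ S w →
    colourDeg S w + length (leaves S w) ≤ leafColourDeg S w + deg S w
  colourDeg+leaves≤ S w = begin
    colourDeg S w + length (leaves S w)
      ≤⟨ +-monoˡ-≤ _ (distinct≤length _≟ᶜ_ {colours S w} split) ⟩
    length (leafColours ++ colours others w) + length (leaves S w)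
      ≡⟨ cong (_+ length (leaves S w)) (length-++ leafColours) ⟩
    leafColourDeg S w + length (colours others w) + length (leaves S w)
      ≡⟨ +-assoc (leafColourDeg S w) _ _ ⟩
    leafColourDeg S w + (length (colours others w) + length (leaves S w))
      ≤⟨ +-monoʳ-≤ (leafColourDeg S w) (+-monoˡ-≤ _ (length-mapMaybe (K w) others)) ⟩
    leafColourDeg S w + (length others + length (leaves S w))
      ≤⟨ +-monoʳ-≤ (leafColourDeg S w) (length-filter-disjoint other? (leaf? S w) (adj? w)
           proj₂ proj₁ proj₁ S) ⟩
    leafColourDeg S w + deg S w ∎
    where
    open ≤-Reasoning
    leafColours = deduplicate _≟ᶜ_ (colours (leaves S w) w)
    other? : Decidable (λ v → Adj w v × ¬ Leaf S w v)
    other? v = adj? w v ×-dec ¬? (leaf? S w v)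
    others = filter other? S
    split : colours S w ⊆ leafColours ++ colours others w
    split x∈ with v , v∈ , eq ← ∈-mapMaybe⁻ S x∈ | leaf? S w v
    ... | yes l = ∈-++⁺ˡ (∈-deduplicate⁺ _≟ᶜ_ (∈-mapMaybe⁺ (∈-filter⁺ (leaf? S w) v∈ l) eq))
    ... | no ¬l = ∈-++⁺ʳ leafColours
      (∈-mapMaybe⁺ (∈-filter⁺ other? v∈ ((_ , eq) , ¬l)) eq)

  -- If x is another leaf at v then w and x are not adjacent, unless vx and vw have
  -- the same colour: the colour of wx would differ from that of vw and from that
  -- of vx.
  leafColourDeg+deg≤ : ∀ S {v w} → w ∈ leaves S v → leafColourDeg S v + deg S w ≤ length S
  leafColourDeg+deg≤ S {v} {w} w∈ = begin
    leafColourDeg S v + deg S w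
      ≤⟨ +-monoˡ-≤ _ (distinct≤length _≟ᶜ_ {colours (leaves S v) v} avoid) ⟩
    length (colours nonNbrs v) + deg S w
      ≤⟨ +-monoˡ-≤ _ (length-mapMaybe (K v) nonNbrs) ⟩
    length nonNbrs + deg S w
      ≡⟨ length-filter+∁ (adj? w) S ⟩
    length S ∎
    where
    open ≤-Reasoning
    nonNbrs = filter (¬? ∘ adj? w) S
    leafOf : ∀ {u} → u ∈ leaves S v → u ∈ S × Leaf S v u
    leafOf = ∈-filter⁻ (leaf? S v)

    w∈S : w ∈ S
    w∈S = proj₁ (leafOf w∈)
    wLeaf : Leaf S v w
    wLeaf = proj₂ (leafOf w∈)
    c₀ = proj₁ (proj₁ wLeaf)
    vw≡c₀ : K v w ≡ just c₀
    vw≡c₀ = proj₂ (proj₁ wLeaf)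

    avoid : colours (leaves S v) v ⊆ colours nonNbrs v
    avoid {c} c∈ with x , x∈ , vx≡c ← ∈-mapMaybe⁻ (leaves S v) c∈ | c ≟ᶜ c₀
    -- The colour of `vw` is witnessed by `w`, which is not its own neighbour.
    ... | yes refl = ∈-mapMaybe⁺ (∈-filter⁺ (¬? ∘ adj? w) w∈S λ adj → adj⇒≢ adj refl) vw≡c₀
    ... | no c≢c₀ with x∈S , (_ , xUnique) ← leafOf x∈ =
      ∈-mapMaybe⁺ (∈-filter⁺ (¬? ∘ adj? w) x∈S ¬adj) vx≡c
      where
      xv≡c : K x v ≡ just c
      xv≡c = trans (K-sym x v) vx≡c
      ¬adj : ¬ Adj w x
      ¬adj (d , wx≡d) = rainbow-free vw≡c₀ wx≡d xv≡c
        -- If `wx` had the colour of `vw`, the leaf property of `w` would force `x ≡ v`; if it had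
        -- that of `vx`, the leaf property of `x` would force `w ≡ v`.
        (λ { refl → adj⇒≢ (_ , vx≡c) (All.lookup (proj₂ wLeaf) x∈S
               (trans wx≡d (sym (trans (K-sym w v) vw≡c₀)))) })
        (λ { refl → adj⇒≢ (_ , vw≡c₀) (All.lookup xUnique w∈S
               (trans (K-sym x w) (trans wx≡d (sym xv≡c)))) })
        c≢c₀

  cheap-vertex : ∀ T {v} → v ∈ T → (∀ {w} → w ∈ T → leafColourDeg T w ≤ leafColourDeg T v) →
    ∃ λ w → w ∈ T × leafColourDeg T w + deg T w ≤ length T
  cheap-vertex T {v} v∈T v-max = go (leaves T v) refl
    where
    go : ∀ L → leaves T v ≡ L → ∃ λ w → w ∈ T × leafColourDeg T w + deg T w ≤ length T
    -- Without leaves `leafColourDeg T v` reduces to 0, and `deg T v` is at most the length of `T`.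
    go [] eq = v , v∈T , ≤-trans
      (≤-reflexive (cong (λ L → colourDeg L v + deg T v) eq))
      (length-filter (adj? v) T)
    go (w ∷ _) eq = w , w∈T ,
      ≤-trans (+-monoˡ-≤ (deg T w) (v-max w∈T)) (leafColourDeg+deg≤ T {v} w∈)
      where
      w∈ : w ∈ leaves T v
      w∈ = subst (w ∈_) (sym eq) (here refl)
      w∈T : w ∈ T
      w∈T = proj₁ (∈-filter⁻ (leaf? T v) {xs = T} w∈)

  cheap-deletion : ∀ T {w} → w ∈ T → leafColourDeg T w + deg T w ≤ length T →
    ∃ λ S → length T ≡ suc (length S) × colourDegSum T ≤ length T + colourDegSum S
  cheap-deletion T {w} w∈T cost with ps , qs , T≡ ← ∈-∃++ w∈T =
    ps ++ qs , ↭-length T↭ ,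
    ≤-trans (deletion-cost T↭) (+-monoˡ-≤ _ (≤-trans (colourDeg+leaves≤ T w) cost))
    where
    T↭ : T ↭ w ∷ ps ++ qs
    T↭ = subst (_↭ w ∷ ps ++ qs) (sym T≡) (shift w ps qs)

  -- Going from k + 1 to k + 2 vertices raises the doubled sum by at most 2(k + 2), which is exactly
  -- the growth of the right-hand side. Strictness comes from a single vertex, where the bound reads
  -- 0 < 2.
  colourDegSum-bound : ∀ k S → length S ≡ suc k → colourDegSum S * 2 < suc k * suc (suc k)
  colourDegSum-bound zero (v ∷ []) refl rewrite K-irrefl v = s≤s z≤n
  colourDegSum-bound (suc k) (v ∷ S) eq
    with _ , u∈ , u-max ← maximiser (leafColourDeg (v ∷ S)) v S
    with _ , w∈ , cheap ← cheap-vertex (v ∷ S) u∈ u-max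
    with T , len , cost ← cheap-deletion (v ∷ S) w∈ cheap = begin-strict
      colourDegSum (v ∷ S) * 2
        ≤⟨ *-monoˡ-≤ 2 cost ⟩
      (length (v ∷ S) + colourDegSum T) * 2
        ≡⟨ cong (λ l → (l + colourDegSum T) * 2) eq ⟩
      (suc (suc k) + colourDegSum T) * 2
        ≡⟨ *-distribʳ-+ 2 (suc (suc k)) (colourDegSum T) ⟩
      suc (suc k) * 2 + colourDegSum T * 2
        <⟨ +-monoʳ-< (suc (suc k) * 2)
             (colourDegSum-bound k T (suc-injective (trans (sym len) eq))) ⟩
      suc (suc k) * 2 + suc k * suc (suc k)
        ≡⟨ solve 1 (λ k → (con 2 :+ k) :* con 2 :+ (con 1 :+ k) :* (con 2 :+ k)
             := (con 2 :+ k) :* (con 3 :+ k)) refl k ⟩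
      suc (suc k) * suc (suc (suc k)) ∎
    where
    open ≤-Reasoning
    open +-*-Solver

-- Application to edge-coloured graphs.

module _ {n} (G : EdgeColouredGraph n) where
  open EdgeColouredGraph G renaming (sym to ∼-sym)

  colourIfAdjacent-just⁻ : ∀ {v u x} → colourIfAdjacent v u ≡ just x →
    ∃ λ (e : v ∼ u) → colour v u e ≡ x
  colourIfAdjacent-just⁻ {v} {u} eq with v ∼? u
  colourIfAdjacent-just⁻ refl | yes e = e , refl

  colourIfAdjacent-irrefl : ∀ v → colourIfAdjacent v v ≡ nothing
  colourIfAdjacent-irrefl v with v ∼? v
  ... | yes e = contradiction e (irrefl refl)
  ... | no _  = refl

  colourIfAdjacent-sym : ∀ u v → colourIfAdjacent u v ≡ colourIfAdjacent v u
  colourIfAdjacent-sym u v with u ∼? v | v ∼? u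
  ... | yes e | yes _ = cong just (colour-sym u v e)
  ... | yes e | no ¬e = contradiction (∼-sym e) ¬e
  ... | no ¬e | yes e = contradiction (∼-sym e) ¬e
  ... | no _  | no _  = refl

  -- Fixing the three vertices reduces the search for a rainbow triangle to finitely many triples;
  -- adjacency proofs cannot be enumerated.
  RainbowAt : Fin n → Fin n → Fin n → Set
  RainbowAt u v w = ∃ λ (t : Triangle) →
    Rainbow t × Triangle.a t ≡ u × Triangle.b t ≡ v × Triangle.c t ≡ w

  rainbowAt? : ∀ u v w → Dec (RainbowAt u v w)
  rainbowAt? u v w with u ∼? v | v ∼? w | w ∼? u
  ... | no ¬e | _ | _ = no λ { (t , _ , refl , refl , refl) → ¬e (Triangle.ab t) }
  ... | _ | no ¬e | _ = no λ { (t , _ , refl , refl , refl) → ¬e (Triangle.bc t) }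
  ... | _ | _ | no ¬e = no λ { (t , _ , refl , refl , refl) → ¬e (Triangle.ca t) }
  ... | yes e | yes f | yes g = map′
    (λ r → record { ab = e ; bc = f ; ca = g } , r , refl , refl , refl)
    -- The adjacency proofs of the given triangle may differ from `e`, `f` and `g`, but `colour`
    -- takes them irrelevantly, so `r` still fits.
    (λ { (_ , r , refl , refl , refl) → r })
    (¬? (colour u v e ≟ colour v w f) ×-dec ¬? (colour v w f ≟ colour w u g)
      ×-dec ¬? (colour w u g ≟ colour u v e))

  rainbowTriangle? : Dec (∃ λ (t : Triangle) → Rainbow t)
  rainbowTriangle? = map′
    (λ (_ , _ , _ , t , r , _) → t , r)
    (λ (t , r) → Triangle.a t , Triangle.b t , Triangle.c t , t , r , refl , refl , refl)
    (Fin.any? λ u → Fin.any? λ v → Fin.any? λ w → rainbowAt? u v w)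

  -- Summed over all vertices, the hypothesis makes twice the colour degree sum at least n(n + 1),
  -- which rainbow-freeness forbids. Decidability of the conclusion turns this contradiction into a
  -- triangle.
  many-colours⇒rainbow-triangle : .{{_ : NonZero n}} →
    (∀ v → n + 1 ≤ colourDegree v * 2) → ∃ λ (t : Triangle) → Rainbow t
  many-colours⇒rainbow-triangle deg≥ with rainbowTriangle?
  ... | yes t = t
  ... | no ¬t = ⊥-elim (n≮n _ (begin-strict
      sum (map colourDegree (allFin n)) * 2
        -- The bound at index k concerns k + 1 vertices, hence `pred n`.
        <⟨ RF.colourDegSum-bound (pred n) (allFin n)
             (trans (length-tabulate {n = n} id) (sym (suc-pred n))) ⟩
      suc (pred n) * suc (suc (pred n))
        ≡⟨ cong (λ m → m * suc m) (suc-pred n) ⟩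
      n * suc n
        ≡⟨ cong₂ _*_ (sym (length-tabulate {n = n} id)) (+-comm 1 n) ⟩
      length (allFin n) * (n + 1)
        ≤⟨ length*m≤k*sum 2 deg≥ (allFin n) ⟩
      sum (map colourDegree (allFin n)) * 2 ∎))
    where
    open ≤-Reasoning
    free : ∀ {u v w x y z} → colourIfAdjacent u v ≡ just x → colourIfAdjacent v w ≡ just y →
      colourIfAdjacent w u ≡ just z → x ≢ y → y ≢ z → z ≢ x → ⊥
    free p q r x≢y y≢z z≢x
      with e , refl ← colourIfAdjacent-just⁻ p
      with f , refl ← colourIfAdjacent-just⁻ q
      with g , refl ← colourIfAdjacent-just⁻ r =
      ¬t (record { ab = e ; bc = f ; ca = g } , x≢y , y≢z , z≢x)
    module RF = RainbowFree Fin._≟_ _≟_ colourIfAdjacent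
      colourIfAdjacent-irrefl colourIfAdjacent-sym free

corollary1 : ∀ (n : ℕ) .{{_ : NonZero n}} (G : EdgeColouredGraph n) →
    let open EdgeColouredGraph G in
    (∀ (v : Fin n) → (+ colourDegree v) / 1 ≥ (+ (n + 1)) / 2) →
    ∃ λ (t : Triangle) → Rainbow t
corollary1 n G deg≥ = many-colours⇒rainbow-triangle G λ v → lemma (deg≥ v)
  where
  -- The order on unnormalised rationals is cross-multiplication, here m * 1 ≤ d * 2 in the
  -- integers.
  lemma : ∀ {d m} → (+ d) / 1 ≥ (+ m) / 2 → m ≤ d * 2
  lemma {d} {m} (*≤* le) = ℤ.drop‿+≤+
    (subst₂ ℤ._≤_ (ℤ.*-identityʳ (+ m)) (sym (ℤ.pos-* d 2)) le)
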